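{- For all integers $h\geq 1$ and $c\geq 1$, there is a $T_{h,3}$-minor-free graph $G$ such that for every graph $H$, if $G$ is contained in $H\boxtimes K_c$, then $H$ has a clique of size $2h$, implying $\mathrm{pw}(H)\geq \mathrm{tw}(H)\geq 2h-1$.
   Context: All graphs are simple, finite and undirected. $T_{h,d}$ denotes the complete $d$-ary tree of radius $h$: the rooted tree in which every non-leaf vertex has exactly $d$ children and every leaf is at distance exactly $h$ from the root. A graph is $T$-minor-free if it does not contain $T$ as a minor. "$G$ is contained in $G'$" means that $G$ is isomorphic to a subgraph of $G'$. The strong product $A\boxtimes B$ has vertex set $V(A)\times V(B)$, where distinct vertices $(v,x),(w,y)$ are adjacent if ($v=w$ and $xy\in E(B)$), or ($x=y$ and $vw\in E(A)$), or ($vw\in E(A)$ and $xy\in E(B)$). $\mathrm{tw}(H)$ and $\mathrm{pw}(H)$ denote the treewidth and pathwidth of $H$, i.e. the minimum of (maximum bag size minus 1) over all tree-decompositions, respectively path-decompositions, of $H$. -}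

module Defs where

open import Data.Fin.Base using (Fin; zero; suc; toℕ; inject₁; fromℕ)
open import Data.Fin.Properties using (*↔×) renaming (_≟_ to _≟ᶠ_)
open import Data.Fin.Subset using (Subset; _∈_; ∣_∣)
open import Data.Integer.Base as ℤ using (ℤ; +_; 1ℤ)
open import Data.List.Base using (map; allFin)
open import Data.List.Extrema.Nat using (max)
open import Data.Nat.Base using (ℕ; zero; suc; _+_; _*_)
open import Data.Nat.Properties using (1+n≢n) renaming (_≟_ to _≟ℕ_)
open import Data.Product.Base using (Σ-syntax; ∃-syntax; _×_; _,_)
open import Data.Product.Function.NonDependent.Propositional using (_×-↔_)
open import Data.Sum.Base using (_⊎_; inj₁; inj₂; [_,_]′)
open import Function.Bundles using (_↔_; Inverse; mk↔ₛ′)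
open import Function.Definitions using (Injective)
open import Function.Properties.Inverse using (↔-refl; ↔-sym; ↔-trans; ↔⇒↣)
open import Level using (0ℓ)
open import Relation.Binary.Construct.Closure.ReflexiveTransitive using (Star)
open import Relation.Binary.Construct.Closure.Symmetric using (SymClosure; fwd; bwd; symmetric)
open import Relation.Binary.Core using (Rel)
open import Relation.Binary.Definitions using (Decidable; DecidableEquality; Symmetric; Irreflexive)
open import Relation.Binary.PropositionalEquality using (_≡_; _≢_; refl; sym; cong; ≢-sym)
open import Relation.Nullary using (¬_)
open import Relation.Nullary.Decidable using (yes; no; map′; ¬?; _×-dec_; _⊎-dec_; via-injection)
open import Relation.Unary using (Pred; U)

record Graph : Set₁ where
  field
    V           : Set
    order       : ℕ
    enumeration : V ↔ Fin order
    E           : Rel V 0ℓ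
    E?          : Decidable E
    E-sym       : Symmetric E
    E-irrefl    : Irreflexive _≡_ E

  _≟_ : DecidableEquality V
  _≟_ = via-injection (↔⇒↣ enumeration) _≟ᶠ_

  VertexSet : Set
  VertexSet = Subset order

open Graph

infix 4 Member

Member : (G : Graph) → V G → VertexSet G → Set
Member G v S = Inverse.to (enumeration G) v ∈ S

syntax Member G v S = v ∈[ G ] S

-- P induces a connected subgraph of G.  The empty set counts as connected;
-- nonemptiness is required separately where it matters.
Connected : (G : Graph) → Pred (V G) 0ℓ → Set
Connected G P = ∀ {u v} → P u → P v →
  Star (λ x y → P x × P y × E G x y) u v

IsClique : (G : Graph) → VertexSet G → Set
IsClique G S = ∀ {u v} → u ∈[ G ] S → v ∈[ G ] S → u ≢ v → E G u v

HasCliqueOfSize : Graph → ℕ → Set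
HasCliqueOfSize G k = Σ[ S ∈ VertexSet G ] IsClique G S × ∣ S ∣ ≡ k

record _IsContainedIn_ (G G′ : Graph) : Set where
  field
    embed     : V G → V G′
    injective : Injective _≡_ _≡_ embed
    edges     : ∀ {u v} → E G u v → E G′ (embed u) (embed v)

-- Contracting each branch set to a vertex, and deleting what is superfluous,
-- turns G into a copy of X.
record _IsMinorOf_ (X G : Graph) : Set where
  field
    branch    : V X → VertexSet G
    nonempty  : ∀ x → ∃[ v ] v ∈[ G ] branch x
    connected : ∀ x → Connected G (λ v → v ∈[ G ] branch x)
    disjoint  : ∀ {x y v} → v ∈[ G ] branch x → v ∈[ G ] branch y → x ≡ y
    edges     : ∀ {x y} → E X x y →
                ∃[ v ] ∃[ w ] v ∈[ G ] branch x × w ∈[ G ] branch y × E G v w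

K : ℕ → Graph
K n = record
  { V           = Fin n
  ; order       = n
  ; enumeration = ↔-refl
  ; E           = _≢_
  ; E?          = λ i j → ¬? (i ≟ᶠ j)
  ; E-sym       = ≢-sym
  ; E-irrefl    = λ i≡j i≢j → i≢j i≡j
  }

infixr 7 _⊠_

-- Distinctness of adjacent pairs is automatic, since A and B are irreflexive.
_⊠_ : Graph → Graph → Graph
A ⊠ B = record
  { V           = V A × V B
  ; order       = order A * order B
  ; enumeration = ↔-trans (enumeration A ×-↔ enumeration B) (↔-sym *↔×)
  ; E           = λ { (v , x) (w , y) →
                      (v ≡ w × E B x y) ⊎ (x ≡ y × E A v w) ⊎ (E A v w × E B x y) }
  ; E?          = λ { (v , x) (w , y) →
                      (_≟_ A v w ×-dec E? B x y) ⊎-dec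
                      (_≟_ B x y ×-dec E? A v w) ⊎-dec
                      (E? A v w ×-dec E? B x y) }
  ; E-sym       = λ { (inj₁ (p , e))        → inj₁ (sym p , E-sym B e)
                    ; (inj₂ (inj₁ (p , e))) → inj₂ (inj₁ (sym p , E-sym A e))
                    ; (inj₂ (inj₂ (d , e))) → inj₂ (inj₂ (E-sym A d , E-sym B e)) }
  ; E-irrefl    = λ { refl (inj₁ (_ , e))        → E-irrefl B refl e
                    ; refl (inj₂ (inj₁ (_ , e))) → E-irrefl A refl e
                    ; refl (inj₂ (inj₂ (e , _))) → E-irrefl A refl e }
  }

module _ {A : Set} {R : Rel A 0ℓ} where

  symClosure? : Decidable R → Decidable (SymClosure R)
  symClosure? R? x y = map′ [ fwd , bwd ]′ (λ { (fwd r) → inj₁ r ; (bwd r) → inj₂ r })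
                            (R? x y ⊎-dec R? y x)

  symClosure-irrefl : Irreflexive _≡_ R → Irreflexive _≡_ (SymClosure R)
  symClosure-irrefl R-irrefl p (fwd r) = R-irrefl p r
  symClosure-irrefl R-irrefl p (bwd r) = R-irrefl (sym p) r

-- The path with n + 1 vertices.
path : ℕ → Graph
path n = record
  { V           = Fin (suc n)
  ; order       = suc n
  ; enumeration = ↔-refl
  ; E           = SymClosure _⋖_
  ; E?          = symClosure? (λ i j → toℕ j ≟ℕ suc (toℕ i))
  ; E-sym       = symmetric _⋖_
  ; E-irrefl    = symClosure-irrefl λ { refl e → 1+n≢n (sym e) }
  }
  where
  _⋖_ : Rel (Fin (suc n)) 0ℓ
  i ⋖ j = toℕ j ≡ suc (toℕ i)

-- A vertex of the complete d-ary tree of radius h is the sequence of at most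
-- h child choices leading to it from the root.
data Node (d : ℕ) : ℕ → Set where
  root  : ∀ {h} → Node d h
  under : ∀ {h} → Fin d → Node d h → Node d (suc h)

data Parent {d : ℕ} : ∀ {h} → Rel (Node d h) 0ℓ where
  root  : ∀ {h} {i} → Parent {h = suc h} root (under i root)
  under : ∀ {h} {i} {u v : Node d h} → Parent u v → Parent (under i u) (under i v)

#nodes : ℕ → ℕ → ℕ
#nodes d zero    = 1
#nodes d (suc h) = suc (d * #nodes d h)

module _ {d : ℕ} where

  node↔ : ∀ h → Node d h ↔ Fin (#nodes d h)
  node↔ zero    = mk↔ₛ′ (λ _ → zero) (λ _ → root) (λ { zero → refl }) (λ { root → refl })
  node↔ (suc h) = mk↔ₛ′ to from to∘from from∘to
    where
    module S = Inverse (↔-trans (↔-refl ×-↔ node↔ h) (↔-sym *↔×))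

    to : Node d (suc h) → Fin (#nodes d (suc h))
    to root        = zero
    to (under i u) = suc (S.to (i , u))

    from : Fin (#nodes d (suc h)) → Node d (suc h)
    from zero    = root
    from (suc k) = let i , u = S.from k in under i u

    to∘from : ∀ k → to (from k) ≡ k
    to∘from zero    = refl
    to∘from (suc k) = cong suc (S.strictlyInverseˡ k)

    from∘to : ∀ u → from (to u) ≡ u
    from∘to root        = refl
    from∘to (under i u) = cong (λ (j , v) → under j v) (S.strictlyInverseʳ (i , u))

  parent? : ∀ {h} → Decidable (Parent {d} {h})
  parent? root        root                  = no λ ()
  parent? root        (under i root)        = yes root
  parent? root        (under i (under j v)) = no λ ()
  parent? (under i u) root                  = no λ ()
  parent? (under i u) (under j v) with i ≟ᶠ j
  ... | yes refl = map′ under (λ { (under p) → p }) (parent? u v)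
  ... | no  i≢j  = no λ { (under _) → i≢j refl }

  parent-irrefl : ∀ {h} → Irreflexive _≡_ (Parent {d} {h})
  parent-irrefl refl (under p) = parent-irrefl refl p

T : ℕ → ℕ → Graph
T h d = record
  { V           = Node d h
  ; order       = #nodes d h
  ; enumeration = node↔ h
  ; E           = SymClosure Parent
  ; E?          = symClosure? parent?
  ; E-sym       = symmetric Parent
  ; E-irrefl    = symClosure-irrefl parent-irrefl
  }

-- Of length k + 3.
record Cycle (G : Graph) (k : ℕ) : Set where
  field
    vertex    : Fin (3 + k) → V G
    injective : Injective _≡_ _≡_ vertex
    step      : ∀ i → E G (vertex (inject₁ i)) (vertex (suc i))
    close     : E G (vertex (fromℕ (2 + k))) (vertex zero)

record IsTree (G : Graph) : Set where
  field
    nonempty  : V G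
    connected : Connected G U
    acyclic   : ∀ k → ¬ Cycle G k

record Decomposition (B G : Graph) : Set where
  field
    bag       : V B → VertexSet G
    vertices  : ∀ v → ∃[ x ] v ∈[ G ] bag x
    edges     : ∀ {v w} → E G v w → ∃[ x ] v ∈[ G ] bag x × w ∈[ G ] bag x
    connected : ∀ v → Connected B (λ x → v ∈[ G ] bag x)

  maxBagSize : ℕ
  maxBagSize =
    max 0 (map (λ i → ∣ bag (Inverse.from (enumeration B) i) ∣) (allFin (order B)))

  -- An integer, so that the graph without vertices has width -1.
  width : ℤ
  width = + maxBagSize ℤ.- 1ℤ

open Decomposition using (width)

TreeDecompositionOfWidth : Graph → ℤ → Set₁
TreeDecompositionOfWidth G k =
  Σ[ B ∈ Graph ] IsTree B × Σ[ D ∈ Decomposition B G ] width D ≡ k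

PathDecompositionOfWidth : Graph → ℤ → Set
PathDecompositionOfWidth G k =
  Σ[ n ∈ ℕ ] Σ[ D ∈ Decomposition (path n) G ] width D ≡ k

IsMinimum : ∀ {ℓ} → Pred ℤ ℓ → Pred ℤ ℓ
IsMinimum P m = P m × (∀ k → P k → m ℤ.≤ k)

-- Relations rather than functions: the minimum is unique, but its existence is
-- immediate constructively only up to double negation, since the tree in
-- TreeDecompositionOfWidth is of unbounded size.
IsTreewidth : Graph → ℤ → Set₁
IsTreewidth G = IsMinimum (TreeDecompositionOfWidth G)

IsPathwidth : Graph → ℤ → Set
IsPathwidth G = IsMinimum (PathDecompositionOfWidth G)

{-# OPTIONS --safe #-}

-- The extremal graphs G_h are built recursively: G_0 is empty, and G_{h+1} is a
-- path on c + 1 vertices together with 2c + 1 copies of G_h for each edge of the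
-- path, all joined completely to both ends of that edge.
--
-- G_{h+1} has no T_{h+1,3} minor: a subtree T_{h,3} below the root does not fit
-- into a copy of G_h, so the three subtrees all meet the path, and the middle
-- one separates the two others, which the root connects.
--
-- If G_{h+1} lies in H ⊠ K_c, then some edge of the path has its ends in
-- different columns x and y, and one of the copies attached there avoids both
-- columns; x and y then extend the clique found for this copy by induction.
--
-- The width bounds hold because a clique lies within a bag of every
-- tree-decomposition.
module Submission where

open import Defs
open import Data.Empty using (⊥)
open import Data.Fin.Base using (Fin; zero; suc; toℕ; inject₁; fromℕ; combine)
open import Data.Fin.Properties as Finₚ
  using (any?; pigeonhole; toℕ-injective; toℕ-inject₁; toℕ-fromℕ; toℕ<n; *↔×; +↔⊎; combine-injective)
open import Data.Fin.Subset using (Subset; inside; outside; _∈_; _∉_; _⊆_; _∪_; ⁅_⁆; ∣_∣)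
  renaming (⊥ to ∅)
open import Data.Fin.Subset.Properties
  using (_∈?_; _⊆?_; p⊆q⇒∣p∣≤∣q∣; x∈p∪q⁻; x∈⁅y⁆⇒x≡y; ∪-identityˡ; ∉⊥; ∣⊥∣≡0)
open import Data.Integer.Base as ℤ using (ℤ; +_; 1ℤ)
import Data.Integer.Properties as ℤₚ
open import Data.List.Base as List using (List; []; _∷_; length; allFin)
open import Data.List.Extrema.Nat using (xs≤max)
import Data.List.Membership.DecPropositional as DecMembership
open import Data.List.Membership.Propositional using () renaming (_∈_ to _∈ˡ_; _∉_ to _∉ˡ_)
open import Data.List.Membership.Propositional.Properties using (∈-map⁺; ∈-allFin; ∈-lookup)
open import Data.List.Relation.Unary.All as All using ()
open import Data.List.Relation.Unary.Any using (here; there)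
open import Data.Nat.Base as ℕ using (ℕ; zero; suc; _+_; _*_; _≤_; _<_)
open import Data.Nat.GeneralisedArithmetic using (fold; fold-+)
open import Data.Nat.Induction using (<-rec)
import Data.Nat.Properties as ℕₚ
open import Data.Product.Base using (Σ-syntax; ∃-syntax; ∃; _×_; _,_; proj₁; proj₂)
open import Data.Product.Function.NonDependent.Propositional using (_×-↔_)
open import Data.Sum.Base using (_⊎_; inj₁; inj₂)
open import Data.Sum.Function.Propositional using (_⊎-↔_)
open import Data.Sum.Properties using (inj₁-injective; inj₂-injective)
open import Data.Vec.Base using (_∷_; here; there)
open import Function.Base using (_∘_; _$_)
open import Function.Bundles using (Inverse)
open import Function.Definitions using (Injective)
open import Function.Properties.Inverse using (↔-refl; ↔-sym; ↔-trans)
open import Level using (0ℓ)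
open import Relation.Binary.Construct.Closure.ReflexiveTransitive as Star using (Star; ε; _◅_; _◅◅_)
open import Relation.Binary.Construct.Closure.Symmetric using (fwd; bwd)
open import Relation.Binary.Core using (Rel)
open import Relation.Binary.Definitions
  using (DecidableEquality; Symmetric; Irreflexive; tri<; tri≈; tri>) renaming (Decidable to Decidable₂)
open import Relation.Binary.PropositionalEquality
  using (_≡_; _≢_; refl; sym; trans; cong; cong₂; subst; ≢-sym)
open import Relation.Nullary using (¬_; Dec; yes; no; contradiction)
open import Relation.Nullary.Decidable using (map′; decidable-stable; ¬?; _×-dec_)
open import Relation.Unary using (Pred; Decidable; U)

open Graph

-- Searching the vertices of a finite graph.

module _ (G : Graph) where

  index : V G → Fin (order G)
  index = Inverse.to (enumeration G)

  vertexAt : Fin (order G) → V G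
  vertexAt = Inverse.from (enumeration G)

  index-vertexAt : ∀ k → index (vertexAt k) ≡ k
  index-vertexAt = Inverse.strictlyInverseˡ (enumeration G)

  vertexAt-index : ∀ v → vertexAt (index v) ≡ v
  vertexAt-index = Inverse.strictlyInverseʳ (enumeration G)

  index-injective : Injective _≡_ _≡_ index
  index-injective {u} {v} p =
    trans (sym (vertexAt-index u)) (trans (cong vertexAt p) (vertexAt-index v))

  anyVertex? : {P : Pred (V G) 0ℓ} → Decidable P → Dec (∃ P)
  anyVertex? {P} P? = map′ (λ (k , p) → vertexAt k , p)
                           (λ (v , p) → index v , subst P (sym (vertexAt-index v)) p)
                           (any? (P? ∘ vertexAt))

  ⊈-witness : ∀ (S S′ : VertexSet G) → ¬ S ⊆ S′ →
              ∃[ v ] v ∈[ G ] S × ¬ v ∈[ G ] S′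
  ⊈-witness S S′ S⊈S′ =
    decidable-stable (anyVertex? (λ v → (index v ∈? S) ×-dec ¬? (index v ∈? S′)))
      λ none → S⊈S′ λ {k} k∈S → decidable-stable (k ∈? S′) λ k∉S′ →
        none (vertexAt k , subst (_∈ S) (sym (index-vertexAt k)) k∈S
                         , k∉S′ ∘ subst (_∈ S′) (index-vertexAt k))

-- Simple paths and orbits.

module _ {A : Set} (R : Rel A 0ℓ) where

  infixr 5 _∷_

  data SimplePath (t : A) : List A → Set where
    [-] : SimplePath t (t ∷ [])
    _∷_ : ∀ {a b xs} → R a b × a ∉ˡ (b ∷ xs) →
          SimplePath t (b ∷ xs) → SimplePath t (a ∷ b ∷ xs)

module _ {A : Set} {R : Rel A 0ℓ} {t : A} where

  suffixFrom : ∀ {a xs} → a ∈ˡ xs → SimplePath R t xs → ∃[ ys ] SimplePath R t (a ∷ ys)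
  suffixFrom (here refl) p       = _ , p
  suffixFrom (there ())  [-]
  suffixFrom (there a∈)  (_ ∷ p) = suffixFrom a∈ p

  -- If the new first vertex already lies on the simple path obtained from the rest, that path is
  -- cut back to this occurrence instead of being extended.
  loopErasure : DecidableEquality A → ∀ {s} → Star R s t → ∃[ xs ] SimplePath R t (s ∷ xs)
  loopErasure _≟A_ ε = [] , [-]
  loopErasure _≟A_ {s} (_◅_ {j = b} r w) with xs , p ← loopErasure _≟A_ w
    with DecMembership._∈?_ _≟A_ s (b ∷ xs)
  ... | yes s∈ = suffixFrom s∈ p
  ... | no  s∉ = b ∷ xs , (r , s∉) ∷ p

  simplePath-injective : ∀ {xs} → SimplePath R t xs → Injective _≡_ _≡_ (List.lookup xs)
  simplePath-injective [-]             {zero}  {zero}  _  = refl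
  simplePath-injective (_ ∷ _)         {zero}  {zero}  _  = refl
  simplePath-injective ((_ , a∉) ∷ _)  {zero}  {suc j} eq = contradiction (subst (_∈ˡ _) (sym eq) (∈-lookup j)) a∉
  simplePath-injective ((_ , a∉) ∷ _)  {suc i} {zero}  eq = contradiction (subst (_∈ˡ _) eq (∈-lookup i)) a∉
  simplePath-injective (_ ∷ p)         {suc i} {suc j} eq = cong suc (simplePath-injective p eq)

  simplePath-step : ∀ {a xs} → SimplePath R t (a ∷ xs) → ∀ i →
                    R (List.lookup (a ∷ xs) (inject₁ i)) (List.lookup (a ∷ xs) (suc i))
  simplePath-step ((r , _) ∷ _) zero    = r
  simplePath-step (_ ∷ p)       (suc i) = simplePath-step p i

  simplePath-end : ∀ {a xs} → SimplePath R t (a ∷ xs) → List.lookup (a ∷ xs) (fromℕ (length xs)) ≡ t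
  simplePath-end [-]     = refl
  simplePath-end (_ ∷ p) = simplePath-end p

-- The witness `d` is `j - i - 1`: the period `suc d` is then visibly positive, and it is at most
-- `j`.
repetition⇒period : ∀ {A : Set} (f : A → A) {x : A} {i j : ℕ} → i < j → fold x f i ≡ fold x f j →
                    ∃[ d ] d < j × fold (fold x f i) f (suc d) ≡ fold x f i
repetition⇒period f {x} {i} {j} i<j eq with d , i+d≡j ← ℕₚ.m≤n⇒∃[o]m+o≡n i<j =
    d , subst (suc d ≤_) j≡ (ℕₚ.m≤m+n (suc d) i)
      , trans (sym (fold-+ x f (suc d))) (trans (cong (fold x f) j≡) (sym eq))
  where
  j≡ : suc d + i ≡ j
  j≡ = trans (cong suc (ℕₚ.+-comm d i)) i+d≡j

-- Bridges and non-backtracking maps in acyclic graphs.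

module _ (B : Graph) where

  WithoutEdge : (x y : V B) → Rel (V B) 0ℓ
  WithoutEdge x y u v = E B u v × ¬ (u ≡ x × v ≡ y) × ¬ (u ≡ y × v ≡ x)

  Avoiding : V B → Rel (V B) 0ℓ
  Avoiding x u v = u ≢ x × v ≢ x × E B u v

  avoiding⇒withoutEdgeˡ : ∀ {x y u v} → Avoiding x u v → WithoutEdge x y u v
  avoiding⇒withoutEdgeˡ (u≢x , v≢x , e) = e , (u≢x ∘ proj₁) , (v≢x ∘ proj₂)

  avoiding⇒withoutEdgeʳ : ∀ {x y u v} → Avoiding y u v → WithoutEdge x y u v
  avoiding⇒withoutEdgeʳ (u≢y , v≢y , e) = e , (v≢y ∘ proj₂) , (u≢y ∘ proj₁)

  withoutEdge-sym : ∀ {x y u v} → WithoutEdge x y u v → WithoutEdge x y v u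
  withoutEdge-sym (e , p , q) = E-sym B e , (λ (a , b) → q (b , a)) , (λ (a , b) → p (b , a))

  within⇒avoiding : ∀ {P : Pred (V B) 0ℓ} {x} → ¬ P x →
                    ∀ {u v} → P u × P v × E B u v → Avoiding x u v
  within⇒avoiding {P} ¬Px (Pu , Pv , e) =
    (λ u≡x → ¬Px (subst P u≡x Pu)) , (λ v≡x → ¬Px (subst P v≡x Pv)) , e

  -- The walk is scanned from its end, so the first edge found to leave `x` is the last one of the
  -- walk, and what follows avoids `x`.
  lastExit : ∀ x {u t} → t ≢ x → Star (λ a b → U a × U b × E B a b) u t →
             Star (Avoiding x) u t ⊎ (∃[ y ] E B x y × Star (Avoiding x) y t)
  lastExit x t≢x ε = inj₁ ε
  lastExit x t≢x (_◅_ {i = a} {j = b} (_ , _ , e) w) with lastExit x t≢x w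
  ... | inj₂ exit = inj₂ exit
  ... | inj₁ w′ with _≟_ B a x
  ...   | yes refl = inj₂ (b , e , w′)
  ...   | no  a≢x with _≟_ B b x | w′
  ...     | no  b≢x  | _  = inj₁ ((a≢x , b≢x , e) ◅ w′)
  -- An empty walk carries no proof that its vertex differs from `x`; here `t ≢ x` supplies it.
  ...     | yes b≡x | ε                 = contradiction b≡x t≢x
  ...     | yes b≡x | (b≢x , _) ◅ _     = contradiction b≡x b≢x

  firstEdgeTowards : Connected B U → ∀ x {t} → t ≢ x →
                     ∃[ y ] E B x y × Star (Avoiding x) y t
  firstEdgeTowards conn x t≢x with lastExit x t≢x (conn {x} _ _)
  ... | inj₂ exit                = exit
  ... | inj₁ ε                   = contradiction refl t≢x
  ... | inj₁ ((x≢x , _) ◅ _)     = contradiction refl x≢x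

  module _ (acyclic : ∀ k → ¬ Cycle B k) where

    -- A second route from `y` to `x`, made simple, closes up with the edge to a cycle. Too short
    -- for that would be only a loop or the removed edge itself.
    edge-isBridge : ∀ {x y} → E B x y → ¬ Star (WithoutEdge x y) y x
    edge-isBridge {x} {y} e w with loopErasure (_≟_ B) w
    ... | []         , [-]                      = E-irrefl B refl e
    ... | _ ∷ []     , ((_ , _ , not) , _) ∷ [-]  = not (refl , refl)
    ... | a ∷ b ∷ xs , p = acyclic (length xs) record
      { vertex    = List.lookup (y ∷ a ∷ b ∷ xs)
      ; injective = simplePath-injective p
      ; step      = λ i → proj₁ (simplePath-step p i)
      ; close     = subst (λ z → E B z y) (sym (simplePath-end p)) e
      }

    module _ (f : V B → V B) (f-edge : ∀ x → E B x (f x)) (f-noBacktrack : ∀ x → f (f x) ≢ x) where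

      -- An orbit of least period is a cycle: a repetition within it would give a shorter period.
      aperiodic : ∀ k x → fold x f (suc k) ≢ x
      aperiodic = <-rec _ noPeriod
        where
        noPeriod : ∀ k → (∀ {j} → j < k → ∀ x → fold x f (suc j) ≢ x) →
                   ∀ x → fold x f (suc k) ≢ x
        -- Periods one and two contradict irreflexivity and the lack of backtracking; from three on
        -- the orbit is long enough for a `Cycle`.
        noPeriod 0 _ x eq = E-irrefl B (sym eq) (f-edge x)
        noPeriod 1 _ x eq = f-noBacktrack x eq
        noPeriod (suc (suc k)) shorter x eq = acyclic k record
          { vertex    = orbit
          ; injective = injective
          ; step      = λ i → subst (λ j → E B (fold x f j) (fold x f (suc (toℕ i))))
                                    (sym (toℕ-inject₁ i)) (f-edge _)
          ; close     = subst (λ j → E B (fold x f j) x) (sym (toℕ-fromℕ (2 + k)))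
                              (subst (E B _) eq (f-edge _))
          }
          where
          orbit : Fin (3 + k) → V B
          orbit i = fold x f (toℕ i)

          noRepeat : ∀ {i j : Fin (3 + k)} → toℕ i < toℕ j → orbit i ≢ orbit j
          noRepeat {i} {j} i<j eq′ = let d , p , period = repetition⇒period f i<j eq′ in
            shorter (ℕₚ.≤-trans p (ℕ.s≤s⁻¹ (toℕ<n j))) _ period

          injective : Injective _≡_ _≡_ orbit
          injective {i} {j} eq′ with ℕₚ.<-cmp (toℕ i) (toℕ j)
          ... | tri< i<j _ _ = contradiction eq′ (noRepeat i<j)
          ... | tri≈ _ i≡j _ = toℕ-injective i≡j
          ... | tri> _ _ j<i = contradiction (sym eq′) (noRepeat j<i)

      -- Among `order B + 1` iterates two coincide, which makes some vertex periodic.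
      nonBacktracking-absurd : V B → ⊥
      nonBacktracking-absurd x =
        let i , j , i<j , eq = pigeonhole (ℕₚ.n<1+n (order B)) (λ i → index B (fold x f (toℕ i)))
            d , _ , period   = repetition⇒period f i<j (index-injective B eq)
        in aperiodic d _ period

-- Cliques lie within bags of tree-decompositions.

-- If every bag misses a vertex of the clique, then moving from x towards the
-- bags of the vertex missed at x is a map on the nodes of the tree without fixed
-- points and, the clique vertices being pairwise in a common bag, without
-- backtracking.
module _ {B H : Graph} (tree : IsTree B) (D : Decomposition B H)
         {S : VertexSet H} (clique : IsClique H S) where

  open Decomposition D
  open IsTree tree using (acyclic) renaming (nonempty to node; connected to tree-connected)

  commonBag : ∀ {u v} → u ∈[ H ] S → v ∈[ H ] S → ∃[ t ] u ∈[ H ] bag t × v ∈[ H ] bag t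
  commonBag {u} {v} u∈S v∈S with _≟_ H u v
  ... | yes refl = let t , v∈t = vertices v in t , v∈t , v∈t
  ... | no  u≢v  = edges (clique u∈S v∈S u≢v)

  module _ (S⊈bag : ∀ x → ¬ S ⊆ bag x) where

    missed : ∀ x → ∃[ v ] v ∈[ H ] S × ¬ v ∈[ H ] bag x
    missed x = ⊈-witness H S (bag x) (S⊈bag x)

    -- The nodes whose bags hold the missed vertex are connected without passing through `x`, so a
    -- single neighbour of `x` leads to all of them.
    towardsMissed : ∀ x → ∃[ y ] E B x y ×
                    (∀ t → proj₁ (missed x) ∈[ H ] bag t → Star (Avoiding B x) y t)
    towardsMissed x =
      let v , _ , v∉x = missed x
          t , v∈t     = vertices v
          y , e , w   = firstEdgeTowards B tree-connected x (λ t≡x → v∉x (subst (λ z → v ∈[ H ] bag z) t≡x v∈t))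
      in y , e , λ t′ v∈t′ → w ◅◅ Star.map (within⇒avoiding B v∉x) (connected v v∈t v∈t′)

    next : V B → V B
    next x = proj₁ (towardsMissed x)

    next-edge : ∀ x → E B x (next x)
    next-edge x = proj₁ (proj₂ (towardsMissed x))

    -- Let `t` hold the vertices missed at `x` and at `next x`. After backtracking, `t` would be
    -- reached from `next x` avoiding `x` and from `x` avoiding `next x`; joined, these walks bypass
    -- the bridge between the two.
    next-noBacktrack : ∀ x → next (next x) ≢ x
    next-noBacktrack x eq =
      let t , u∈t , v∈t = commonBag (proj₁ (proj₂ (missed x))) (proj₁ (proj₂ (missed (next x))))
      in edge-isBridge B acyclic (next-edge x)
          (Star.map (avoiding⇒withoutEdgeˡ B) (proj₂ (proj₂ (towardsMissed x)) t u∈t) ◅◅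
           Star.reverse (withoutEdge-sym B)
             (Star.map (avoiding⇒withoutEdgeʳ B)
               (subst (λ z → Star (Avoiding B (next x)) z t) eq
                 (proj₂ (proj₂ (towardsMissed (next x))) t v∈t))))

  clique⊆bag : ∃[ x ] S ⊆ bag x
  -- Containment in some bag is decidable, so the contradiction yields an actual node.
  clique⊆bag = decidable-stable (anyVertex? B (λ x → S ⊆? bag x)) λ none →
    let S⊈bag : ∀ x → ¬ S ⊆ bag x
        S⊈bag x S⊆ = none (x , λ {k} → S⊆ {k})
    in
    nonBacktracking-absurd B acyclic (next S⊈bag) (next-edge S⊈bag) (next-noBacktrack S⊈bag) node

  ∣clique∣-1≤width : + ∣ S ∣ ℤ.- 1ℤ ℤ.≤ width
  ∣clique∣-1≤width =
    let x , S⊆ = clique⊆bag in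
    ℤₚ.+-monoˡ-≤ (ℤ.- 1ℤ) (ℤ.+≤+ (ℕₚ.≤-trans (p⊆q⇒∣p∣≤∣q∣ S⊆) (bag≤max x)))
    where
    bagSize : Fin (order B) → ℕ
    bagSize i = ∣ bag (vertexAt B i) ∣

    bag≤max : ∀ x → ∣ bag x ∣ ≤ maxBagSize
    bag≤max x = subst (λ z → ∣ bag z ∣ ≤ maxBagSize) (vertexAt-index B x)
      (All.lookup (xs≤max 0 (List.map bagSize (allFin _)))
                  (∈-map⁺ bagSize (∈-allFin (index B x))))

-- Paths are trees.

path-reachesZero : ∀ n (i : Fin (suc n)) → Star (λ a b → U a × U b × E (path n) a b) i zero
path-reachesZero n i = go (toℕ i) i refl
  where
  -- The recursion is on `toℕ i`, since `inject₁ i` is not structurally smaller than `suc i`.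
  go : ∀ m (i : Fin (suc n)) → toℕ i ≡ m → Star (λ a b → U a × U b × E (path n) a b) i zero
  go _       zero    _  = ε
  go (suc m) (suc i) eq = (_ , _ , bwd (cong suc (sym (toℕ-inject₁ i)))) ◅
                          go m (inject₁ i) (trans (toℕ-inject₁ i) (ℕₚ.suc-injective eq))

Adjacent : Rel ℕ 0ℓ
Adjacent a b = b ≡ suc a ⊎ a ≡ suc b

-- A step down after a step up would return to the value two positions back, against injectivity;
-- hence the first step decides all directions.
ascending : ∀ m (a : Fin (2 + m) → ℕ) → (∀ i → Adjacent (a (inject₁ i)) (a (suc i))) →
            Injective _≡_ _≡_ a → a (suc zero) ≡ suc (a zero) →
            a (fromℕ (suc m)) ≡ suc m + a zero
ascending zero    a step inj up = up
ascending (suc m) a step inj up with step (suc zero)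
... | inj₁ up′  = trans (ascending m (a ∘ suc) (step ∘ suc) (Finₚ.suc-injective ∘ inj) up′)
                        (trans (cong (λ z → suc m + z) up) (ℕₚ.+-suc (suc m) (a zero)))
... | inj₂ down = contradiction (inj (ℕₚ.suc-injective (trans (sym up) down))) λ ()

descending : ∀ m (a : Fin (2 + m) → ℕ) → (∀ i → Adjacent (a (inject₁ i)) (a (suc i))) →
             Injective _≡_ _≡_ a → a zero ≡ suc (a (suc zero)) →
             a zero ≡ suc m + a (fromℕ (suc m))
descending zero    a step inj down = down
descending (suc m) a step inj down with step (suc zero)
... | inj₁ up    = contradiction (inj (trans down (sym up))) λ ()
... | inj₂ down′ = trans down (cong suc (descending m (a ∘ suc) (step ∘ suc) (Finₚ.suc-injective ∘ inj) down′))

-- A cycle never turns back, so on a path it would be monotone and could not close up.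
path-acyclic : ∀ n k → ¬ Cycle (path n) k
path-acyclic n k C = go (steps zero)
  where
  open Cycle C

  a : Fin (3 + k) → ℕ
  a = toℕ ∘ vertex

  adjacent : ∀ {u v} → E (path n) u v → Adjacent (toℕ u) (toℕ v)
  adjacent (fwd p) = inj₁ p
  adjacent (bwd p) = inj₂ p

  steps : ∀ i → Adjacent (a (inject₁ i)) (a (suc i))
  steps i = adjacent (step i)

  go : ¬ Adjacent (a zero) (a (suc zero))
  -- First and last vertex are `2 + k` apart, whereas the closing edge spans a distance of one.
  go (inj₁ up) with ascending (suc k) a steps (injective ∘ toℕ-injective) up | adjacent close
  ... | eq | inj₁ p = ℕₚ.m≢1+n+m _ (trans p (cong suc eq))
  ... | eq | inj₂ p = ℕₚ.m≢1+n+m _ (ℕₚ.suc-injective (trans (sym p) eq))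
  go (inj₂ down) with descending (suc k) a steps (injective ∘ toℕ-injective) down | adjacent close
  ... | eq | inj₁ p = ℕₚ.m≢1+n+m _ (ℕₚ.suc-injective (trans (sym p) eq))
  ... | eq | inj₂ p = ℕₚ.m≢1+n+m _ (trans p (cong suc eq))

path-isTree : ∀ n → IsTree (path n)
path-isTree n = record
  { nonempty  = zero
  ; connected = λ {u} {v} _ _ → path-reachesZero n u ◅◅
                Star.reverse (λ (_ , _ , e) → _ , _ , E-sym (path n) e) (path-reachesZero n v)
  ; acyclic   = path-acyclic n
  }

-- Width bounds.

treewidth≤pathwidth : ∀ H {tw pw} → IsTreewidth H tw → IsPathwidth H pw → tw ℤ.≤ pw
treewidth≤pathwidth H (_ , tw≤) ((n , D , eq) , _) = tw≤ _ (path n , path-isTree n , D , eq)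

clique≤treewidth : ∀ H {S tw} → IsClique H S → IsTreewidth H tw → + ∣ S ∣ ℤ.- 1ℤ ℤ.≤ tw
clique≤treewidth H clique ((B , tree , D , refl) , _) = ∣clique∣-1≤width tree D clique

-- Extending cliques by a vertex.

∣⁅x⁆∪p∣ : ∀ {n} {x : Fin n} {p : Subset n} → x ∉ p → ∣ ⁅ x ⁆ ∪ p ∣ ≡ suc ∣ p ∣
∣⁅x⁆∪p∣ {x = zero}  {inside  ∷ p} x∉p = contradiction here x∉p
∣⁅x⁆∪p∣ {x = zero}  {outside ∷ p} x∉p = cong (suc ∘ ∣_∣) (∪-identityˡ p)
∣⁅x⁆∪p∣ {x = suc x} {inside  ∷ p} x∉p = cong suc (∣⁅x⁆∪p∣ (x∉p ∘ there))
∣⁅x⁆∪p∣ {x = suc x} {outside ∷ p} x∉p = ∣⁅x⁆∪p∣ (x∉p ∘ there)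

CliqueWithin : (H : Graph) → Pred (V H) 0ℓ → ℕ → Set
CliqueWithin H P k =
  Σ[ S ∈ VertexSet H ] IsClique H S × ∣ S ∣ ≡ k × (∀ {u} → u ∈[ H ] S → P u)

-- Adjacency of `x` to all of `P` also keeps `x` out of the old clique, by irreflexivity, so the
-- size does grow.
insertVertex : ∀ H {P Q : Pred (V H) 0ℓ} {k x} → Q x → (∀ {u} → P u → E H x u × Q u) →
               CliqueWithin H P k → CliqueWithin H Q (suc k)
insertVertex H {P} {Q} {k} {x} Qx P⇒ (S , clique , size , S⊆P) =
    ⁅ index H x ⁆ ∪ S , clique′ , trans (∣⁅x⁆∪p∣ x∉S) (cong suc size) , within
  where
  x∉S : index H x ∉ S
  x∉S x∈S = E-irrefl H refl (proj₁ (P⇒ (S⊆P x∈S)))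

  split : ∀ {u} → u ∈[ H ] ⁅ index H x ⁆ ∪ S → u ≡ x ⊎ u ∈[ H ] S
  split u∈ with x∈p∪q⁻ ⁅ index H x ⁆ S u∈
  ... | inj₁ u∈⁅x⁆ = inj₁ (index-injective H (x∈⁅y⁆⇒x≡y _ u∈⁅x⁆))
  ... | inj₂ u∈S   = inj₂ u∈S

  clique′ : IsClique H (⁅ index H x ⁆ ∪ S)
  clique′ u∈ v∈ u≢v with split u∈ | split v∈
  ... | inj₁ refl | inj₁ refl = contradiction refl u≢v
  ... | inj₁ refl | inj₂ v∈S  = proj₁ (P⇒ (S⊆P v∈S))
  ... | inj₂ u∈S  | inj₁ refl = E-sym H (proj₁ (P⇒ (S⊆P u∈S)))
  ... | inj₂ u∈S  | inj₂ v∈S  = clique u∈S v∈S u≢v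

  within : ∀ {u} → u ∈[ H ] ⁅ index H x ⁆ ∪ S → Q u
  within u∈ with split u∈
  ... | inj₁ refl = Qx
  ... | inj₂ u∈S  = proj₂ (P⇒ (S⊆P u∈S))

-- Minor models and complete trees.

-- Minor models whose branch sets need not be decidable.
record Model (X G : Graph) : Set₁ where
  field
    branch    : V X → Pred (V G) 0ℓ
    nonempty  : ∀ x → ∃ (branch x)
    connected : ∀ x → Connected G (branch x)
    disjoint  : ∀ {x y v} → branch x v → branch y v → x ≡ y
    edges     : ∀ {x y} → E X x y → ∃[ v ] ∃[ w ] branch x v × branch y w × E G v w

minor⇒model : ∀ {X G} → X IsMinorOf G → Model X G
minor⇒model {G = G} M = record
  { branch    = λ x v → v ∈[ G ] M.branch x
  ; nonempty  = M.nonempty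
  ; connected = M.connected
  ; disjoint  = M.disjoint
  ; edges     = M.edges
  }
  where module M = _IsMinorOf_ M

tree-connected : ∀ h d → Connected (T h d) U
tree-connected h d _ _ =
  Star.reverse (λ (_ , _ , e) → _ , _ , E-sym (T h d) e) (fromRoot _) ◅◅ fromRoot _
  where
  fromRoot : ∀ {h} (u : Node d h) → Star (λ x y → U x × U y × E (T h d) x y) root u
  fromRoot root        = ε
  fromRoot (under i u) = (_ , _ , fwd root) ◅ Star.gmap (under i) lift (fromRoot u)
    where
    lift : ∀ {h x y} → U x × U y × E (T h d) x y → U x × U y × E (T (suc h) d) (under i x) (under i y)
    lift (_ , _ , fwd p) = _ , _ , fwd (under p)
    lift (_ , _ , bwd p) = _ , _ , bwd (under p)

childModel : ∀ {h d G} → Fin d → Model (T (suc h) d) G → Model (T h d) G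
childModel i M = record
  { branch    = branch ∘ under i
  ; nonempty  = nonempty ∘ under i
  ; connected = connected ∘ under i
  ; disjoint  = λ p q → under-injective (disjoint p q)
  ; edges     = λ { (fwd p) → edges (fwd (under p)) ; (bwd p) → edges (bwd (under p)) }
  }
  where
  open Model M
  under-injective : ∀ {x y} → under i x ≡ under i y → x ≡ y
  under-injective refl = refl

module _ {X G : Graph} (M : Model X G) where

  open Model M

  Covered : Pred (V G) 0ℓ
  Covered v = ∃[ x ] branch x v

  -- A walk in `X` lifts to `G`: connectedness is used inside each branch set, a model edge between
  -- consecutive ones.
  covered-connected : Connected X U → Connected G Covered
  covered-connected conn (x , p) (y , q) = along (conn {x} {y} _ _) p q
    where
    along : ∀ {x y u v} → Star (λ a b → U a × U b × E X a b) x y → branch x u → branch y v →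
            Star (λ a b → Covered a × Covered b × E G a b) u v
    along {x} ε p q = Star.map (λ (a , b , e) → (x , a) , (x , b) , e) (connected x p q)
    along {x} (_◅_ {j = y} (_ , _ , e) w) p q =
      let a , b , a∈ , b∈ , ab = edges e in
      Star.map (λ (a , b , e) → (x , a) , (x , b) , e) (connected x p a∈) ◅◅
      ((x , a∈) , (y , b∈) , ab) ◅ along w b∈ q

-- Decorated paths and their tree minors.

-- The path p₀ … p_c in which, for every edge p_e p_{e+1}, both ends are joined
-- to all vertices of N disjoint copies of G.
module Decorated (c N : ℕ) (G : Graph) where

  Vertex : Set
  Vertex = Fin (suc c) ⊎ (Fin c × Fin N × V G)

  -- Numbering the two ends by `Fin 2` makes adjacency decidable by finite search and lets pairs of
  -- an end and a layer be counted.
  end : Fin c → Fin 2 → Fin (suc c)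
  end e zero       = inject₁ e
  end e (suc zero) = suc e

  Adj : Rel Vertex 0ℓ
  Adj (inj₁ i)            (inj₁ j)               = E (path c) i j
  Adj (inj₁ i)            (inj₂ (e , _))         = ∃[ b ] i ≡ end e b
  Adj (inj₂ (e , _))      (inj₁ i)               = ∃[ b ] i ≡ end e b
  Adj (inj₂ (e , j , u))  (inj₂ (e′ , j′ , v))   = e ≡ e′ × j ≡ j′ × E G u v

  adj? : Decidable₂ Adj
  adj? (inj₁ i)           (inj₁ j)             = E? (path c) i j
  adj? (inj₁ i)           (inj₂ (e , _))       = any? λ b → i Finₚ.≟ end e b
  adj? (inj₂ (e , _))     (inj₁ i)             = any? λ b → i Finₚ.≟ end e b
  adj? (inj₂ (e , j , u)) (inj₂ (e′ , j′ , v)) = (e Finₚ.≟ e′) ×-dec (j Finₚ.≟ j′) ×-dec E? G u v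

  adj-sym : Symmetric Adj
  adj-sym {inj₁ i} {inj₁ j} e                  = E-sym (path c) e
  adj-sym {inj₁ i} {inj₂ _} e                  = e
  adj-sym {inj₂ _} {inj₁ i} e                  = e
  adj-sym {inj₂ _} {inj₂ _} (refl , refl , e)  = refl , refl , E-sym G e

  adj-irrefl : Irreflexive _≡_ Adj
  adj-irrefl {inj₁ i} refl e           = E-irrefl (path c) refl e
  adj-irrefl {inj₂ _} refl (_ , _ , e) = E-irrefl G refl e

  decorated : Graph
  decorated = record
    { V           = Vertex
    ; order       = suc c + c * (N * order G)
    ; enumeration = ↔-trans
        (↔-refl ⊎-↔ ↔-trans (↔-refl ×-↔ ↔-trans (↔-refl ×-↔ enumeration G) (↔-sym *↔×)) (↔-sym *↔×))
        (↔-sym +↔⊎)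
    ; E           = Adj
    ; E?          = adj?
    ; E-sym       = λ {u} {v} → adj-sym {u} {v}
    ; E-irrefl    = λ {u} {v} → adj-irrefl {u} {v}
    }

  module _ {P : Pred Vertex 0ℓ} (offPath : ∀ i → ¬ P (inj₁ i)) where

    -- Distinct copies are not adjacent, so a walk can leave a copy only through the path.
    staysInCopy : ∀ {e j u v} → P (inj₂ (e , j , u)) →
                  Star (λ a b → P a × P b × Adj a b) (inj₂ (e , j , u)) v →
                  ∃[ w ] v ≡ inj₂ (e , j , w) ×
                    Star (λ a b → P (inj₂ (e , j , a)) × P (inj₂ (e , j , b)) × E G a b) u w
    staysInCopy Pu ε = _ , refl , ε
    staysInCopy Pu (_◅_ {j = inj₁ i} (_ , Pi , _) _) = contradiction Pi (offPath i)
    staysInCopy Pu (_◅_ {j = inj₂ _} (_ , Pv , refl , refl , e) w) =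
      let w′ , eq , walk = staysInCopy Pv w in w′ , eq , (Pu , Pv , e) ◅ walk

  -- The union of the branch sets is connected, so it stays in the copy that holds a vertex of the
  -- branch set of `x₀`.
  offPath⇒model : ∀ {X} (M : Model X decorated) → V X → Connected X U →
                  (∀ i → ¬ Covered M (inj₁ i)) → Model X G
  offPath⇒model {X} M x₀ conn offPath with Model.nonempty M x₀
  ... | inj₁ i , p = contradiction (x₀ , p) (offPath i)
  ... | inj₂ (e , j , w₀) , p₀ = record
    { branch    = λ x w → branch x (inj₂ (e , j , w))
    ; nonempty  = λ x → let v , p = nonempty x ; w , eq = inCopy (x , p) in
                        w , subst (branch x) eq p
    ; connected = connectedInCopy
    ; disjoint  = disjoint
    ; edges     = edgesInCopy
    }
    where
    open Model M

    inCopy : ∀ {v} → Covered M v → ∃[ w ] v ≡ inj₂ (e , j , w)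
    inCopy q = let w , eq , _ = staysInCopy offPath (x₀ , p₀) (covered-connected M conn (x₀ , p₀) q)
               in w , eq

    connectedInCopy : ∀ x → Connected G (λ w → branch x (inj₂ (e , j , w)))
    connectedInCopy x p q with staysInCopy (λ i r → offPath i (x , r)) p (connected x p q)
    ... | _ , refl , walk = walk

    edgesInCopy : ∀ {x y} → E X x y → ∃[ v ] ∃[ w ]
                  branch x (inj₂ (e , j , v)) × branch y (inj₂ (e , j , w)) × E G v w
    edgesInCopy {x} {y} xy with a , b , p , q , ab ← edges xy with inCopy (x , p) | inCopy (y , q)
    ... | v , refl | w , refl = v , w , p , q , proj₂ (proj₂ ab)

  -- A copy is placed at the left end of its edge, so both ends of the edge of a copy left of `b`
  -- are at or before `b`.
  LeftOf : Fin (suc c) → Pred Vertex 0ℓ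
  LeftOf b (inj₁ i)       = toℕ i < toℕ b
  LeftOf b (inj₂ (e , _)) = toℕ e < toℕ b

  -- Neither a path edge nor a copy straddles `b`: the left side can be left only through `b`
  -- itself.
  leftOf-step : ∀ b u v → Adj u v → v ≢ inj₁ b → LeftOf b u → LeftOf b v
  leftOf-step b (inj₁ i) (inj₁ j) (fwd p) v≢b i<b =
    ℕₚ.≤∧≢⇒< (subst (_≤ toℕ b) (sym p) i<b) (v≢b ∘ cong inj₁ ∘ toℕ-injective)
  leftOf-step b (inj₁ i) (inj₁ j) (bwd p) v≢b i<b =
    ℕₚ.<-trans (ℕₚ.≤-reflexive (sym p)) i<b
  leftOf-step b (inj₁ i) (inj₂ (e , _)) (zero     , refl) _ i<b = subst (_< toℕ b) (toℕ-inject₁ e) i<b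
  leftOf-step b (inj₁ i) (inj₂ (e , _)) (suc zero , refl) _ i<b = ℕₚ.<-trans (ℕₚ.n<1+n _) i<b
  leftOf-step b (inj₂ (e , _)) (inj₁ i) (zero     , refl) _ e<b = subst (_< toℕ b) (sym (toℕ-inject₁ e)) e<b
  leftOf-step b (inj₂ (e , _)) (inj₁ i) (suc zero , refl) v≢b e<b =
    ℕₚ.≤∧≢⇒< e<b (v≢b ∘ cong inj₁ ∘ toℕ-injective)
  leftOf-step b (inj₂ _) (inj₂ _) (refl , _) _ e<b = e<b

  leftOf-connected : ∀ {P : Pred Vertex 0ℓ} {b} → Connected decorated P → ¬ P (inj₁ b) →
                     ∀ {u v} → P u → P v → LeftOf b u → LeftOf b v
  leftOf-connected {P} {b} conn ¬Pb Pu Pv = along (conn Pu Pv)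
    where
    along : ∀ {u v} → Star (λ x y → P x × P y × Adj x y) u v → LeftOf b u → LeftOf b v
    along ε = λ l → l
    along (_◅_ {i = x} {j = y} (_ , Py , e) w) =
      along w ∘ leftOf-step b x y e λ eq → ¬Pb (subst P eq Py)

  decorated-treeMinorFree : ∀ {h} → ¬ Model (T h 3) G → ¬ Model (T (suc h) 3) decorated
  decorated-treeMinorFree {h} free M =
    -- Branch sets need not be decidable, so `meets` is doubly negated; the goal being empty, this
    -- suffices.
    meets 0F λ (p , p∈) → meets 1F λ (q , q∈) → meets 2F λ (r , r∈) →
      compare p∈ q∈ r∈
    where
    open Model M

    0F 1F 2F : Fin 3
    0F = zero
    1F = suc zero
    2F = suc (suc zero)

    Child : Fin 3 → Pred Vertex 0ℓ
    Child i = Covered (childModel i M)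

    child-connected : ∀ i → Connected decorated (Child i)
    child-connected i = covered-connected (childModel i M) (tree-connected h 3)

    meets : ∀ i → ¬ ¬ (∃[ p ] Child i (inj₁ p))
    meets i none = free (offPath⇒model (childModel i M) root (tree-connected h 3) λ p p∈ → none (p , p∈))

    child-disjoint : ∀ {i j v} → i ≢ j → Child i v → ¬ Child j v
    child-disjoint i≢j (_ , p) (_ , q) with disjoint p q
    ... | refl = i≢j refl

    root-disjoint : ∀ {i v} → Child i v → ¬ branch root v
    root-disjoint (_ , p) q with disjoint p q
    ... | ()

    -- Since `q` belongs to child `j`, the two other children and the root's branch set each lie on
    -- one side of it. Read from the bottom up, being left of `q` passes from `p` through child `i`,
    -- the root and child `k` to `r`.
    separated : ∀ {i j k p q r} → i ≢ j → j ≢ k →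
                Child i (inj₁ p) → Child j (inj₁ q) → Child k (inj₁ r) →
                toℕ p < toℕ q → toℕ q < toℕ r → ⊥
    separated {i} {j} {k} {q = q} i≢j j≢k p∈ q∈ r∈ p<q q<r =
      let a , s , a∈ , s∈ , as = edges {root} {under i root} (fwd root)
          b , t , b∈ , t∈ , bt = edges {root} {under k root} (fwd root)
      in ℕₚ.<-asym q<r $
         leftOf-connected (child-connected k) (child-disjoint j≢k q∈) (_ , t∈) r∈ $
         leftOf-step q b t bt (λ eq → child-disjoint j≢k q∈ (subst (Child k) eq (_ , t∈))) $
         leftOf-connected (connected root) (root-disjoint q∈) a∈ b∈ $
         leftOf-step q s a (adj-sym {a} {s} as) (λ eq → root-disjoint q∈ (subst (branch root) eq a∈)) $
         leftOf-connected (child-connected i) (child-disjoint (≢-sym i≢j) q∈) p∈ (_ , s∈) p<q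

    compare : ∀ {p q r} → Child 0F (inj₁ p) → Child 1F (inj₁ q) → ¬ Child 2F (inj₁ r)
    -- Ties contradict disjointness; in every strict order the middle vertex is passed second to
    -- `separated`.
    compare {p} {q} {r} p∈ q∈ r∈ with Finₚ.<-cmp p q | Finₚ.<-cmp q r | Finₚ.<-cmp p r
    ... | tri≈ _ refl _ | _             | _             = child-disjoint (λ ()) p∈ q∈
    ... | _             | tri≈ _ refl _ | _             = child-disjoint (λ ()) q∈ r∈
    ... | _             | _             | tri≈ _ refl _ = child-disjoint (λ ()) p∈ r∈
    ... | tri< p<q _ _  | tri< q<r _ _  | _             = separated (λ ()) (λ ()) p∈ q∈ r∈ p<q q<r
    ... | tri< p<q _ _  | tri> _ _ r<q  | tri< p<r _ _  = separated (λ ()) (λ ()) p∈ r∈ q∈ p<r r<q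
    ... | tri< p<q _ _  | tri> _ _ r<q  | tri> _ _ r<p  = separated (λ ()) (λ ()) r∈ p∈ q∈ r<p p<q
    ... | tri> _ _ q<p  | tri< q<r _ _  | tri< p<r _ _  = separated (λ ()) (λ ()) q∈ p∈ r∈ q<p p<r
    ... | tri> _ _ q<p  | tri< q<r _ _  | tri> _ _ r<p  = separated (λ ()) (λ ()) q∈ r∈ p∈ q<r r<p
    ... | tri> _ _ q<p  | tri> _ _ r<q  | _             = separated (λ ()) (λ ()) r∈ q∈ p∈ r<q q<p

-- Embeddings into strong products with complete graphs.

constantOnPath : ∀ {A : Set} c (f : Fin (suc c) → A) → (∀ e → f (inject₁ e) ≡ f (suc e)) →
                 ∀ i → f zero ≡ f i
constantOnPath c       f eq zero    = refl
constantOnPath (suc c) f eq (suc i) = trans (eq zero) (constantOnPath c (f ∘ suc) (eq ∘ suc) i)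

⊠-columns : ∀ {A B u v} → E (A ⊠ B) u v → proj₁ u ≢ proj₁ v → E A (proj₁ u) (proj₁ v)
⊠-columns (inj₁ (eq , _))       u≢v = contradiction eq u≢v
⊠-columns (inj₂ (inj₁ (_ , e))) _   = e
⊠-columns (inj₂ (inj₂ (e , _))) _   = e

module _ {G H : Graph} {c : ℕ} (F : G IsContainedIn (H ⊠ K c)) where

  open _IsContainedIn_ F

  column : V G → V H
  column v = proj₁ (embed v)

  layer : V G → Fin c
  layer v = proj₂ (embed v)

  column-layer-injective : ∀ {u v} → column u ≡ column v → layer u ≡ layer v → u ≡ v
  column-layer-injective p q = injective (cong₂ _,_ p q)

  Occupied : Pred (V H) 0ℓ
  Occupied x = ∃[ v ] column v ≡ x

  column-adjacent : ∀ {u v} → E G u v → column u ≢ column v → E H (column u) (column v)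
  column-adjacent e = ⊠-columns {H} {K c} (edges e)

-- Confining the clique to `Occupied F` strengthens the induction: a clique found for a copy
-- consists of columns met by that copy, which are adjacent to the columns of both path ends if the
-- copy avoids these.
ForcesClique : ℕ → Graph → ℕ → Set₁
ForcesClique c G k = ∀ H (F : G IsContainedIn (H ⊠ K c)) → CliqueWithin H (Occupied F) k

-- Two columns have 2c vertices, so among more than 2c copies one avoids them both.
decorated-forcesClique : ∀ {c G k} → ForcesClique c G k →
                         ForcesClique c (Decorated.decorated c (suc (2 * c)) G) (2 + k)
decorated-forcesClique {c} {G} {k} forces H F =
  let e , x≢y   = splitEdge
      j , avoid = freeCopy e
      F′        = copy e j
      x = inj₁ (inject₁ e)
      y = inj₁ (suc e)
      pathEdge : E (path c) (inject₁ e) (suc e)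
      pathEdge = fwd (cong suc (sym (toℕ-inject₁ e)))
  -- The column of `y` is inserted first, while the predicate `P` keeps track of adjacency to the
  -- column of `x`, which is inserted last.
  in insertVertex H {P = λ u → E H (column F x) u × Occupied F u} (x , refl) (λ p → p)
       (insertVertex H {P = Occupied F′} (column-adjacent F {x} {y} pathEdge x≢y , y , refl)
         (λ { (w , refl) →
              column-adjacent F {y} {inj₂ (e , j , w)} (suc zero , refl) (λ eq → avoid (suc zero , w , sym eq))
            , column-adjacent F {x} {inj₂ (e , j , w)} (zero , refl) (λ eq → avoid (zero , w , sym eq))
            , _ , refl })
         (forces H F′))
  where
  open Decorated c (suc (2 * c)) G

  -- Otherwise all `c + 1` path vertices share one column, which has only `c` layers.
  splitEdge : ∃[ e ] column F (inj₁ (inject₁ e)) ≢ column F (inj₁ (suc e))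
  splitEdge = decidable-stable (any? λ e → ¬? (_≟_ H _ _)) λ none →
    let sameColumn = constantOnPath c (column F ∘ inj₁) λ e →
                       decidable-stable (_≟_ H _ _) λ x≢y → none (e , x≢y)
        i , j , i<j , eq = pigeonhole (ℕₚ.n<1+n c) (layer F ∘ inj₁)
    in Finₚ.<⇒≢ i<j (inj₁-injective
         (column-layer-injective F (trans (sym (sameColumn i)) (sameColumn j)) eq))

  Hit : Fin c → Fin (suc (2 * c)) → Set
  Hit e j = ∃[ b ] ∃[ w ] column F (inj₂ (e , j , w)) ≡ column F (inj₁ (end e b))

  freeCopy : ∀ e → ∃[ j ] ¬ Hit e j
  freeCopy e = Finₚ.¬∀⟶∃¬ _ (Hit e) (λ j → any? λ b → anyVertex? G λ w → _≟_ H _ _) λ hit →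
    -- A hit copy has a vertex in the column of one of the ends; its slot, the end with the layer,
    -- is one of `2 * c`. Copies with equal slots would share a vertex of the product.
    let slot = λ j → combine (proj₁ (hit j)) (layer F (inj₂ (e , j , proj₁ (proj₂ (hit j)))))
        i , j , i<j , eq = pigeonhole (ℕₚ.n<1+n (2 * c)) slot
        sameEnd , sameLayer = combine-injective (proj₁ (hit i)) _ (proj₁ (hit j)) _ eq
        sameColumn = trans (proj₂ (proj₂ (hit i)))
                       (trans (cong (column F ∘ inj₁ ∘ end e) sameEnd) (sym (proj₂ (proj₂ (hit j)))))
    in Finₚ.<⇒≢ i<j (cong (proj₁ ∘ proj₂) (inj₂-injective (column-layer-injective F sameColumn sameLayer)))

  copy : Fin c → Fin (suc (2 * c)) → G IsContainedIn (H ⊠ K c)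
  copy e j = record
    { embed     = λ w → embed (inj₂ (e , j , w))
    ; injective = λ eq → cong (proj₂ ∘ proj₂) (inj₂-injective (injective eq))
    ; edges     = λ {u} {v} uv → edges {inj₂ (e , j , u)} {inj₂ (e , j , v)} (refl , refl , uv)
    }
    where open _IsContainedIn_ F

-- The extremal graphs.

extremal : ℕ → ℕ → Graph
extremal c zero    = K 0
extremal c (suc h) = Decorated.decorated c (suc (2 * c)) (extremal c h)

extremal-treeMinorFree : ∀ c h → ¬ Model (T h 3) (extremal c h)
extremal-treeMinorFree c zero    M with Model.nonempty M root
... | () , _
extremal-treeMinorFree c (suc h) = Decorated.decorated-treeMinorFree c _ _ (extremal-treeMinorFree c h)

extremal-forcesClique : ∀ c h → ForcesClique c (extremal c h) (2 * h)
extremal-forcesClique c zero    H F = ∅ , (λ u∈∅ → contradiction u∈∅ ∉⊥) , ∣⊥∣≡0 (order H) , λ u∈∅ → contradiction u∈∅ ∉⊥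
extremal-forcesClique c (suc h) = subst (ForcesClique c _) (sym (ℕₚ.*-suc 2 h))
                                        (decorated-forcesClique (extremal-forcesClique c h))

proposition3 : ∀ (h c : ℕ) → 1 ≤ h → 1 ≤ c →
    Σ[ G ∈ Graph ] ¬ (T h 3 IsMinorOf G) ×
    (∀ (H : Graph) → G IsContainedIn (H ⊠ K c) →
    HasCliqueOfSize H (2 * h) ×
    (∀ (tw pw : ℤ) → IsTreewidth H tw → IsPathwidth H pw →
    tw ℤ.≤ pw × + (2 * h) ℤ.- 1ℤ ℤ.≤ tw))
proposition3 h c _ _ =
  extremal c h , extremal-treeMinorFree c h ∘ minor⇒model , λ H F →
  let S , clique , size , _ = extremal-forcesClique c h H F in
  (S , clique , size) , λ tw pw isTw isPw →
    treewidth≤pathwidth H isTw isPw ,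
    subst (λ k → + k ℤ.- 1ℤ ℤ.≤ tw) size (clique≤treewidth H clique isTw)
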